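{- Let $R \cong R_1\times\cdots\times R_r$ ($r\ge 1$) with finite commutative local rings $R_i$. Then the nullity of the zero-divisor graph $\Gamma(R)$ satisfies $$\eta(\Gamma(R)) \;\ge\; \prod_{i=1}^r \# R_i - \prod_{i=1}^r \# U(R_i) - \prod_{i=1}^r\big(\# V(\Gamma_E(R_i))+2\big) + 1 .$$
   Context: Rings are finite and commutative with $1\neq 0$; $U(R)$ is the set of units. The zero-divisor graph $\Gamma(R)$ has as vertex set $Z^*(R)$ the set of non-zero zero-divisors of $R$, and two (not necessarily distinct) vertices $x,y$ are adjacent iff $xy=0$; loops are kept, so the adjacency matrix $A(\Gamma(R))$ has diagonal entry $1$ at $x$ iff $x^2=0$. The nullity $\eta(G)$ of a graph $G$ is the multiplicity of the eigenvalue $0$ of its adjacency matrix $A(G)$, i.e. $\#V(G)-\operatorname{rank}A(G)$ (it is $0$ for the graph with no vertices). For $r\in R$ let $[r]_R=\{s\in R \mid \mathrm{ann}_R(r)=\mathrm{ann}_R(s)\}$, and let $R_E=\{[r]_R \mid r\in R\}$. The compressed zero-divisor graph $\Gamma_E(R)$ has vertex set $R_E\setminus\{[0]_R,[1]_R\}$, with $[x]_R,[y]_R$ adjacent iff $xy=0$. $\#S$ is the cardinality of a set $S$. -}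

module Defs where

open import Algebra.Bundles using (CommutativeRing)
open import Algebra.Definitions using (Invertible)
open import Algebra.Morphism.Structures using (module RingMorphisms)
import Algebra.Properties.Semiring.Sum as SemiringSum
open import Data.Bool.Base using (if_then_else_)
open import Data.Fin.Base using (Fin; zero; suc; punchIn)
import Data.Fin.Properties as Fin
open import Data.List.Base using (List; length; lookup; filter; deduplicate; tabulate)
open import Data.Nat.Base as ℕ using (ℕ; zero; suc; z≤n; s≤s; _∸_)
import Data.Nat.Properties as ℕ
open import Data.Product.Base using (Σ; ∃; _×_; _,_; proj₁; proj₂)
open import Data.Rational.Base using (ℚ; 0ℚ; 1ℚ; _+_; _*_; -_; _-_; 1/_; ≢-nonZero)
import Data.Rational.Properties as ℚ
open import Data.Rational.Solver using (module +-*-Solver)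
open import Data.Sum.Base using (_⊎_; inj₁; inj₂)
open import Data.Vec.Functional using (foldr; insertAt; []) renaming (_∷_ to _◂_)
import Data.Vec.Functional.Properties as Vector
open import Function.Base using (_∘_)
open import Function.Bundles using (Inverse)
open import Level using (Level; _⊔_)
open import Relation.Binary.Core using (Rel)
open import Relation.Binary.Definitions using (Decidable; Symmetric)
open import Relation.Binary.PropositionalEquality as ≡
  using (_≡_; _≢_; _≗_; refl; cong; cong₂; module ≡-Reasoning)
open import Relation.Nullary
  using (Dec; yes; no; does; ¬_; ¬?; _×-dec_; _→-dec_; contradiction)
open import Relation.Nullary.Decidable using (map′)
open import Relation.Unary as Unary using (Pred; _∈_; _∉_; _⊆_; _≐_)

private
  variable
    a ℓ a₁ ℓ₁ a₂ ℓ₂ ℓᵖ : Level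
    k m n : ℕ

∏ : (Fin n → ℕ) → ℕ
∏ = foldr ℕ._*_ 1

------------------------------------------------------------------------
-- Linear algebra over ℚ

open SemiringSum (CommutativeRing.semiring ℚ.+-*-commutativeRing)

LinearlyIndependent : (Fin k → Fin m → ℚ) → Set
LinearlyIndependent {k} v =
  ∀ (c : Fin k → ℚ) → (∀ j → ∑[ i < k ] (c i * v i j) ≡ 0ℚ) → ∀ i → c i ≡ 0ℚ

Matrix : ℕ → ℕ → Set
Matrix m n = Fin m → Fin n → ℚ

column : Matrix m n → Fin n → Fin m → ℚ
column M j i = M i j

-- A choice f of columns is not required to be injective: a linearly
-- independent family has no repetitions.
IndependentColumns : Matrix m n → ℕ → Set
IndependentColumns {n = n} M k =
  Σ (Fin k → Fin n) λ f → LinearlyIndependent (column M ∘ f)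

IsRank : Matrix m n → ℕ → Set
IsRank M k = IndependentColumns M k × (∀ l → IndependentColumns M l → l ℕ.≤ k)

-- The rank exists: linear independence is decided by Gaussian elimination,
-- and an independent family of vectors of length m has at most m members.
private
  module Elimination {k m} (v : Fin (suc k) → Fin (suc m) → ℚ) (p : Fin (suc k))
                     (pivot≢0 : v p zero ≢ 0ℚ) where
    instance _ = ≢-nonZero pivot≢0

    a⁻¹ : ℚ
    a⁻¹ = 1/ v p zero

    rest : Fin k → Fin (suc m) → ℚ
    rest i = v (punchIn p i)

    reduced : Fin k → Fin m → ℚ
    reduced i j = rest i (suc j) - rest i zero * a⁻¹ * v p (suc j)

    combine : (Fin k → ℚ) → Fin (suc m) → ℚ
    combine c j = ∑[ i < k ] (c i * rest i j)

    open ≡-Reasoning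
    open +-*-Solver

    combine-reduced : ∀ c j → ∑[ i < k ] (c i * reduced i j) ≡
                      combine c (suc j) + combine c zero * (- (a⁻¹ * v p (suc j)))
    combine-reduced c j = begin
      ∑[ i < k ] (c i * reduced i j)
        ≡⟨ sum-cong-≗ (λ i → solve 5 (λ x r s b w → x :* (r :- s :* b :* w) :=
             x :* r :+ x :* s :* (:- (b :* w))) refl
             (c i) (rest i (suc j)) (rest i zero) a⁻¹ (v p (suc j))) ⟩
      ∑[ i < k ] (c i * rest i (suc j) + c i * rest i zero * t)
        ≡⟨ ∑-distrib-+ (λ i → c i * rest i (suc j)) (λ i → c i * rest i zero * t) ⟩
      combine c (suc j) + ∑[ i < k ] (c i * rest i zero * t)
        ≡⟨ cong (combine c (suc j) +_) (*-distribʳ-sum t (λ i → c i * rest i zero)) ⟨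
      combine c (suc j) + combine c zero * t ∎
      where t = - (a⁻¹ * v p (suc j))

    split : ∀ c j → ∑[ i < suc k ] (c i * v i j) ≡ c p * v p j + combine (c ∘ punchIn p) j
    split c j = sum-remove {i = p} (λ i → c i * v i j)

    a*a⁻¹ : v p zero * a⁻¹ ≡ 1ℚ
    a*a⁻¹ = ℚ.*-inverseʳ (v p zero)

    to : LinearlyIndependent reduced → LinearlyIndependent v
    to li c eq = λ i → go i (i Fin.≟ p)
      where
      c′ = c ∘ punchIn p

      eq′ : ∀ j → c p * v p j + combine c′ j ≡ 0ℚ
      eq′ j = ≡.trans (≡.sym (split c j)) (eq j)

      c′≡0 : ∀ i → c′ i ≡ 0ℚ
      c′≡0 = li c′ λ j → let w = v p (suc j) ; x = v p zero in begin
        ∑[ i < k ] (c′ i * reduced i j)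
          ≡⟨ combine-reduced c′ j ⟩
        combine c′ (suc j) + combine c′ zero * (- (a⁻¹ * w))
          ≡⟨ solve 6 (λ s z b w q x → s :+ z :* (:- (b :* w)) :=
               (q :* w :+ s) :+ (q :* x :+ z) :* (:- (b :* w))
                 :+ q :* w :* (x :* b :- con 1ℚ)) refl
               (combine c′ (suc j)) (combine c′ zero) a⁻¹ w (c p) x ⟩
        (c p * w + combine c′ (suc j)) + (c p * x + combine c′ zero) * (- (a⁻¹ * w))
          + c p * w * (x * a⁻¹ - 1ℚ)
          ≡⟨ cong₂ _+_ (cong₂ (λ y z → y + z * (- (a⁻¹ * w))) (eq′ (suc j)) (eq′ zero))
               (cong (λ y → c p * w * (y - 1ℚ)) a*a⁻¹) ⟩
        0ℚ + 0ℚ * (- (a⁻¹ * w)) + c p * w * (1ℚ - 1ℚ)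
          ≡⟨ solve 2 (λ y z → con 0ℚ :+ con 0ℚ :* y :+ z :* (con 1ℚ :- con 1ℚ) := con 0ℚ) refl
               (- (a⁻¹ * w)) (c p * w) ⟩
        0ℚ ∎

      combine≡0 : combine c′ zero ≡ 0ℚ
      combine≡0 = ≡.trans
        (sum-cong-≗ λ i → ≡.trans (cong (_* rest i zero) (c′≡0 i)) (ℚ.*-zeroˡ (rest i zero)))
        (sum-replicate-zero k)

      cp≡0 : c p ≡ 0ℚ
      cp≡0 = let x = v p zero in begin
        c p
          ≡⟨ solve 3 (λ q x b → q := (q :* x :+ con 0ℚ) :* b :- q :* (x :* b :- con 1ℚ)) refl
               (c p) x a⁻¹ ⟩
        (c p * x + 0ℚ) * a⁻¹ - c p * (x * a⁻¹ - 1ℚ)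
          ≡⟨ cong₂ (λ y z → y * a⁻¹ - c p * (z - 1ℚ))
               (≡.trans (cong (c p * x +_) (≡.sym combine≡0)) (eq′ zero)) a*a⁻¹ ⟩
        0ℚ * a⁻¹ - c p * (1ℚ - 1ℚ)
          ≡⟨ solve 2 (λ b q → con 0ℚ :* b :- q :* (con 1ℚ :- con 1ℚ) := con 0ℚ) refl a⁻¹ (c p) ⟩
        0ℚ ∎

      go : ∀ i → Dec (i ≡ p) → c i ≡ 0ℚ
      go i (yes refl) = cp≡0
      go i (no i≢p)   = ≡.trans
        (cong c (≡.sym (Fin.punchIn-punchOut (i≢p ∘ ≡.sym)))) (c′≡0 _)

    from : LinearlyIndependent v → LinearlyIndependent reduced
    from li c′ eq i = ≡.trans (≡.sym (Vector.insertAt-punchIn c′ p q i)) (li c eq′ (punchIn p i))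
      where
      q = - (combine c′ zero * a⁻¹)
      c = insertAt c′ p q

      split′ : ∀ j → ∑[ i < suc k ] (c i * v i j) ≡ q * v p j + combine c′ j
      split′ j = ≡.trans (split c j) (cong₂ _+_
        (cong (_* v p j) (Vector.insertAt-lookup c′ p q))
        (sum-cong-≗ λ i → cong (_* rest i j) (Vector.insertAt-punchIn c′ p q i)))

      eq′ : ∀ j → ∑[ i < suc k ] (c i * v i j) ≡ 0ℚ
      eq′ zero = begin
        ∑[ i < suc k ] (c i * v i zero)    ≡⟨ split′ zero ⟩
        q * v p zero + combine c′ zero
          ≡⟨ solve 3 (λ z b x → (:- (z :* b)) :* x :+ z := z :* (con 1ℚ :- x :* b)) refl
               (combine c′ zero) a⁻¹ (v p zero) ⟩
        combine c′ zero * (1ℚ - v p zero * a⁻¹)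
          ≡⟨ cong (λ y → combine c′ zero * (1ℚ - y)) a*a⁻¹ ⟩
        combine c′ zero * (1ℚ - 1ℚ)        ≡⟨ ℚ.*-zeroʳ (combine c′ zero) ⟩
        0ℚ ∎
      eq′ (suc j) = begin
        ∑[ i < suc k ] (c i * v i (suc j))  ≡⟨ split′ (suc j) ⟩
        q * v p (suc j) + combine c′ (suc j)
          ≡⟨ solve 4 (λ z b w s → (:- (z :* b)) :* w :+ s := s :+ z :* (:- (b :* w))) refl
               (combine c′ zero) a⁻¹ (v p (suc j)) (combine c′ (suc j)) ⟩
        combine c′ (suc j) + combine c′ zero * (- (a⁻¹ * v p (suc j)))
          ≡⟨ combine-reduced c′ j ⟨
        ∑[ i < k ] (c′ i * reduced i j)     ≡⟨ eq j ⟩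
        0ℚ ∎

  gauss : (v : Fin k → Fin m → ℚ) →
          (LinearlyIndependent v × k ℕ.≤ m) ⊎ ¬ LinearlyIndependent v
  gauss {zero}  {m}     v = inj₁ ((λ _ _ ()) , z≤n)
  gauss {suc k} {zero}  v = inj₂ λ li → contradiction (li (λ _ → 1ℚ) (λ ()) zero) λ ()
  gauss {suc k} {suc m} v with Fin.any? (λ i → ¬? (v i zero ℚ.≟ 0ℚ))
  ... | yes (p , pivot≢0) with gauss (Elimination.reduced v p pivot≢0)
  ...   | inj₁ (li , k≤m) = inj₁ (Elimination.to v p pivot≢0 li , s≤s k≤m)
  ...   | inj₂ ¬li        = inj₂ (¬li ∘ Elimination.from v p pivot≢0)
  gauss {suc k} {suc m} v | no ¬pivot with gauss (λ i j → v i (suc j))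
  ... | inj₁ (li , k≤m) = inj₁ ((λ c eq → li c (eq ∘ suc)) , ℕ.m≤n⇒m≤1+n k≤m)
  ... | inj₂ ¬li        = inj₂ λ li → ¬li λ c eq → li c λ
    { (suc j) → eq j
    ; zero    → ≡.trans
        (sum-cong-≗ λ i → ≡.trans (cong (c i *_) (v₀≡0 i)) (ℚ.*-zeroʳ (c i)))
        (sum-replicate-zero (suc k))
    }
    where
    v₀≡0 : ∀ i → v i zero ≡ 0ℚ
    v₀≡0 i with v i zero ℚ.≟ 0ℚ
    ... | yes eq = eq
    ... | no neq = contradiction (i , neq) ¬pivot

  linearlyIndependent? : (v : Fin k → Fin m → ℚ) → Dec (LinearlyIndependent v)
  linearlyIndependent? v with gauss v
  ... | inj₁ (li , _) = yes li
  ... | inj₂ ¬li      = no ¬li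

  independent⇒≤ : (v : Fin k → Fin m → ℚ) → LinearlyIndependent v → k ℕ.≤ m
  independent⇒≤ v li with gauss v
  ... | inj₁ (_ , k≤m) = k≤m
  ... | inj₂ ¬li       = contradiction li ¬li

  anyFun? : ∀ {k n} {P : (Fin k → Fin n) → Set} → (∀ {f g} → f ≗ g → P f → P g) →
            (∀ f → Dec (P f)) → Dec (∃ P)
  anyFun? {zero}  resp P? = map′ (λ P[] → [] , P[]) (λ (_ , Pf) → resp (λ ()) Pf) (P? [])
  anyFun? {suc k} resp P? = map′
    (λ (x , g , Pxg) → x ◂ g , Pxg)
    (λ (f , Pf) → f zero , f ∘ suc , resp (λ { zero → refl ; (suc _) → refl }) Pf)
    (Fin.any? λ x → anyFun?
      (λ f≗g → resp λ { zero → refl ; (suc i) → f≗g i })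
      (λ g → P? (x ◂ g)))

  independentColumns? : (M : Matrix m n) → Unary.Decidable (IndependentColumns M)
  independentColumns? M k = anyFun?
    (λ f≗g li c eq → li c λ j →
      ≡.trans (sum-cong-≗ λ i → cong (λ x → c i * M j x) (f≗g i)) (eq j))
    (λ f → linearlyIndependent? (column M ∘ f))

  maximum : ∀ {P : ℕ → Set} → Unary.Decidable P → P 0 → ∀ b → (∀ l → P l → l ℕ.≤ b) →
            ∃ λ k → P k × (∀ l → P l → l ℕ.≤ k)
  maximum P? P0 zero    bound = 0 , P0 , bound
  maximum {P} P? P0 (suc b) bound with P? (suc b)
  ... | yes Pb = suc b , Pb , bound
  ... | no ¬Pb = maximum P? P0 b λ l Pl →
    ℕ.≤-pred (ℕ.≤∧≢⇒< (bound l Pl) λ { refl → ¬Pb Pl })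

abstract
  rank-exists : (M : Matrix m n) → ∃ (IsRank M)
  rank-exists {m} M = maximum (independentColumns? M) ((λ ()) , λ _ _ ()) m
    λ l (f , li) → independent⇒≤ (column M ∘ f) li

rank : Matrix m n → ℕ
rank M = proj₁ (rank-exists M)

rank-isRank : (M : Matrix m n) → IsRank M (rank M)
rank-isRank M = proj₂ (rank-exists M)

------------------------------------------------------------------------
-- Finite graphs, loops allowed

record Graph a : Set (Level.suc a) where
  field
    order : ℕ
    _~_   : Rel (Fin order) a
    _~?_  : Decidable _~_
    ~-sym : Symmetric _~_

  adjacencyMatrix : Matrix order order
  adjacencyMatrix i j = if does (i ~? j) then 1ℚ else 0ℚ

  -- An adjacency matrix has integer entries, so its rank over ℚ is its
  -- rank over ℝ.  The subtraction never truncates.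
  nullity : ℕ
  nullity = order ∸ rank adjacencyMatrix

------------------------------------------------------------------------
-- Rings

-- An ideal need not be a decidable predicate; maximality is phrased
-- without a disjunction, so that it is meaningful constructively.
module _ (R : CommutativeRing a ℓ) where
  open CommutativeRing R
    using (Carrier; _≈_; 0#; 1#) renaming (_+_ to _+ᴿ_; _*_ to _*ᴿ_)

  record IsIdeal (I : Pred Carrier ℓᵖ) : Set (a ⊔ ℓ ⊔ ℓᵖ) where
    field
      resp     : ∀ {x y} → x ≈ y → x ∈ I → y ∈ I
      0∈       : 0# ∈ I
      +-closed : ∀ {x y} → x ∈ I → y ∈ I → (x +ᴿ y) ∈ I
      *-closed : ∀ r {x} → x ∈ I → (r *ᴿ x) ∈ I

  IsProperIdeal : Pred Carrier ℓᵖ → Set (a ⊔ ℓ ⊔ ℓᵖ)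
  IsProperIdeal I = IsIdeal I × 1# ∉ I

  IsMaximalIdeal : Pred Carrier ℓᵖ → Set (a ⊔ ℓ ⊔ Level.suc ℓᵖ)
  IsMaximalIdeal {ℓᵖ} I =
    IsProperIdeal I × (∀ (J : Pred Carrier ℓᵖ) → IsProperIdeal J → I ⊆ J → J ⊆ I)

  IsLocal : Set (Level.suc (a ⊔ ℓ))
  IsLocal = Σ (Pred Carrier (a ⊔ ℓ)) λ M →
    IsMaximalIdeal M × (∀ (N : Pred Carrier (a ⊔ ℓ)) → IsMaximalIdeal N → N ≐ M)

_≅_ : CommutativeRing a₁ ℓ₁ → CommutativeRing a₂ ℓ₂ → Set (a₁ ⊔ ℓ₁ ⊔ a₂ ⊔ ℓ₂)
R ≅ S = ∃ (RingMorphisms.IsRingIsomorphism (rawRing R) (rawRing S))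
  where open CommutativeRing using (rawRing)

Product : (Fin n → CommutativeRing a ℓ) → CommutativeRing a ℓ
Product {n} R = record
  { Carrier = ∀ i → Carrier i
  ; _≈_     = λ x y → ∀ i → R._≈_ i (x i) (y i)
  ; _+_     = λ x y i → R._+_ i (x i) (y i)
  ; _*_     = λ x y i → R._*_ i (x i) (y i)
  ; -_      = λ x i → R.-_ i (x i)
  ; 0#      = λ i → R.0# i
  ; 1#      = λ i → R.1# i
  ; isCommutativeRing = record
    { isRing = record
      { +-isAbelianGroup = record
        { isGroup = record
          { isMonoid = record
            { isSemigroup = record
              { isMagma = record
                { isEquivalence = record
                  { refl  = λ i → R.refl i
                  ; sym   = λ x≈y i → R.sym i (x≈y i)
                  ; trans = λ x≈y y≈z i → R.trans i (x≈y i) (y≈z i)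
                  }
                ; ∙-cong = λ x≈y u≈v i → R.+-cong i (x≈y i) (u≈v i)
                }
              ; assoc = λ x y z i → R.+-assoc i (x i) (y i) (z i)
              }
            ; identity = (λ x i → R.+-identityˡ i (x i)) , (λ x i → R.+-identityʳ i (x i))
            }
          ; inverse = (λ x i → R.-‿inverseˡ i (x i)) , (λ x i → R.-‿inverseʳ i (x i))
          ; ⁻¹-cong = λ x≈y i → R.-‿cong i (x≈y i)
          }
        ; comm = λ x y i → R.+-comm i (x i) (y i)
        }
      ; *-cong     = λ x≈y u≈v i → R.*-cong i (x≈y i) (u≈v i)
      ; *-assoc    = λ x y z i → R.*-assoc i (x i) (y i) (z i)
      ; *-identity = (λ x i → R.*-identityˡ i (x i)) , (λ x i → R.*-identityʳ i (x i))
      ; distrib    = (λ x y z i → R.distribˡ i (x i) (y i) (z i))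
                   , (λ x y z i → R.distribʳ i (x i) (y i) (z i))
      }
    ; *-comm = λ x y i → R.*-comm i (x i) (y i)
    }
  }
  where
  module R (i : Fin n) = CommutativeRing (R i)
  open R using (Carrier)

record FiniteCommutativeRing c ℓ : Set (Level.suc (c ⊔ ℓ)) where
  field
    commutativeRing : CommutativeRing c ℓ

  open CommutativeRing commutativeRing public
    renaming (_+_ to _+ᴿ_; _*_ to _*ᴿ_; -_ to -ᴿ_; _-_ to _-ᴿ_)

  field
    1≉0         : ¬ 1# ≈ 0#
    card        : ℕ
    enumeration : Inverse setoid (≡.setoid (Fin card))

  open Inverse enumeration using ()
    renaming (to to index; from to element; to-cong to index-cong;
              strictlyInverseʳ to element-index)

  elements : List Carrier
  elements = tabulate element

  _≈?_ : Decidable _≈_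
  x ≈? y = map′
    (λ eq → trans (sym (element-index x)) (trans (reflexive (cong element eq)) (element-index y)))
    index-cong
    (index x Fin.≟ index y)

  ∃? : {P : Pred Carrier ℓᵖ} → (∀ {x y} → x ≈ y → P x → P y) → Unary.Decidable P → Dec (∃ P)
  ∃? resp P? = map′ (λ (i , Pi) → element i , Pi)
    (λ (x , Px) → index x , resp (sym (element-index x)) Px) (Fin.any? (P? ∘ element))

  ∀? : {P : Pred Carrier ℓᵖ} → (∀ {x y} → x ≈ y → P x → P y) → Unary.Decidable P → Dec (∀ x → P x)
  ∀? resp P? = map′ (λ Pi x → resp (element-index x) (Pi (index x)))
    (λ Px i → Px (element i)) (Fin.all? (P? ∘ element))

  IsUnit : Pred Carrier (c ⊔ ℓ)
  IsUnit = Invertible _≈_ 1# _*ᴿ_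

  isUnit? : Unary.Decidable IsUnit
  isUnit? x = ∃?
    (λ y≈z (yx≈1 , xy≈1) → trans (*-congʳ (sym y≈z)) yx≈1 , trans (*-congˡ (sym y≈z)) xy≈1)
    (λ y → ((y *ᴿ x) ≈? 1#) ×-dec ((x *ᴿ y) ≈? 1#))

  units : List Carrier
  units = filter isUnit? elements

  IsZeroDivisor : Pred Carrier (c ⊔ ℓ)
  IsZeroDivisor x = ∃ λ y → ¬ y ≈ 0# × (x *ᴿ y) ≈ 0#

  isZeroDivisor? : Unary.Decidable IsZeroDivisor
  isZeroDivisor? x = ∃?
    (λ y≈z (y≉0 , xy≈0) → (λ z≈0 → y≉0 (trans y≈z z≈0)) , trans (*-congˡ (sym y≈z)) xy≈0)
    (λ y → ¬? (y ≈? 0#) ×-dec ((x *ᴿ y) ≈? 0#))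

  Z* : List Carrier
  Z* = filter (λ x → ¬? (x ≈? 0#) ×-dec isZeroDivisor? x) elements

  Ann : Carrier → Pred Carrier ℓ
  Ann x y = (x *ᴿ y) ≈ 0#

  -- x ∼ y says that [x] and [y] are the same class.
  _∼_ : Rel Carrier (c ⊔ ℓ)
  x ∼ y = Ann x ≐ Ann y

  private
    Ann⊆? : ∀ x y → Dec (Ann x ⊆ Ann y)
    Ann⊆? x y = map′ (λ f {z} → f z) (λ f z → f {z}) (∀?
      (λ z≈w f xw≈0 → trans (*-congˡ (sym z≈w)) (f (trans (*-congˡ z≈w) xw≈0)))
      (λ z → ((x *ᴿ z) ≈? 0#) →-dec ((y *ᴿ z) ≈? 0#)))

  _∼?_ : Decidable _∼_
  x ∼? y = Ann⊆? x y ×-dec Ann⊆? y x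

  -- One representative of each class.
  classes : List Carrier
  classes = deduplicate _∼?_ elements

  zeroProductGraph : List Carrier → Graph ℓ
  zeroProductGraph xs = record
    { order = length xs
    ; _~_   = λ i j → (lookup xs i *ᴿ lookup xs j) ≈ 0#
    ; _~?_  = λ i j → (lookup xs i *ᴿ lookup xs j) ≈? 0#
    ; ~-sym = trans (*-comm _ _)
    }

  Γ : Graph ℓ
  Γ = zeroProductGraph Z*

  -- Adjacency is tested on representatives; it does not depend on their choice.
  ΓE : Graph ℓ
  ΓE = zeroProductGraph (filter (λ x → ¬? (x ∼? 0#) ×-dec ¬? (x ∼? 1#)) classes)

-- Two vertices of Γ(R) with the same annihilator have equal columns, so an
-- independent family of columns meets each annihilator class at most once, and
-- only classes other than [0] and [1]: rank + 2 ≤ #R_E.  Annihilators in a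
-- product are computed componentwise, so #R_E ≤ ∏ #(Rᵢ)_E.  Every element of a
-- finite ring is zero, a unit or a non-zero zero-divisor, which gives
-- ∏ #Rᵢ ≤ #Z* + ∏ #U(Rᵢ) + 1.
module Submission where

open import Defs
open import Level using (Level)
open import Data.Nat.Base using (ℕ)
open import Data.Fin.Base using (Fin)
open import Data.List.Base using (length)
open import Data.Integer.Base using (+_; _+_; _-_; _≥_)
import Data.Nat.Base as ℕ
open FiniteCommutativeRing using (commutativeRing; card; units; Γ; ΓE)
open Graph using (order; nullity)

open import Algebra.Bundles using (CommutativeRing)
open import Algebra.Morphism.Structures using (module RingMorphisms)
import Algebra.Properties.Group as GroupProperties
import Algebra.Properties.Ring as RingProperties
import Algebra.Properties.Semiring.Sum as SemiringSum
open import Data.Bool.Base using (if_then_else_)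
open import Data.Fin.Base using (zero; suc; _↑ˡ_; _↑ʳ_; combine; remQuot; punchIn; punchOut)
import Data.Fin.Properties as Fin
import Data.Integer.Base as ℤ
import Data.Integer.Properties as ℤ
import Data.Integer.Solver as ℤ-Solver
open import Data.List.Base using (List; lookup; filter)
import Data.List.Membership.Setoid as SetoidMembership
import Data.List.Membership.Setoid.Properties as Membership
open import Data.List.Membership.Propositional.Properties using (∈-lookup)
open import Data.List.Relation.Unary.All as All using ()
open import Data.List.Relation.Unary.All.Properties using (all-filter)
open import Data.List.Relation.Unary.Any as Any using ()
open import Data.List.Relation.Unary.Any.Properties using (lookup-index)
open import Data.Nat.Base using (zero; suc)
import Data.Nat.Properties as ℕ
import Data.Nat.Solver as ℕ-Solver
open import Data.Product.Base using (∃; _×_; _,_; proj₁; proj₂; uncurry; swap)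
open import Data.Rational.Base as ℚ using (ℚ; 0ℚ; 1ℚ)
import Data.Rational.Properties as ℚ
import Data.Rational.Solver as ℚ-Solver
open import Data.Sum.Base using (_⊎_; inj₁; inj₂)
open import Data.Vec.Functional using (_++_; insertAt; []) renaming (_∷_ to _◂_)
import Data.Vec.Functional.Properties as Vector
open import Function.Base using (_∘_)
open import Function.Bundles using (Inverse; mk⇔)
open import Level using (_⊔_)
open import Relation.Binary.Bundles using (Setoid)
open import Relation.Binary.Core using (Rel)
open import Relation.Binary.Definitions using (Symmetric; Transitive)
open import Relation.Binary.PropositionalEquality as ≡ using (_≡_; _≢_; _≗_; refl; cong; cong₂)
open import Relation.Nullary using (¬_; ¬?; _×-dec_; yes; no; contradiction)
open import Relation.Nullary.Decidable using (does-⇔)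
open import Relation.Unary using (Pred)

open SemiringSum (CommutativeRing.semiring ℚ.+-*-commutativeRing)

private
  variable
    a p ℓ c₁ ℓ₁ c₂ ℓ₂ : Level
    k m n : ℕ

-- Finite covering families

Covers : {A : Set a} → Rel A ℓ → (Fin n → A) → Set _
Covers _≈_ d = ∀ x → ∃ λ k → x ≈ d k

-- Pigeonhole principle up to a relation: sending `i` to the index that covers `e i` is injective,
-- because two entries covered by the same `d k` are related through it.
distinct⇒≤ : {A : Set a} {_≈_ : Rel A ℓ} → Symmetric _≈_ → Transitive _≈_ →
             (e : Fin n → A) → (∀ {i j} → e i ≈ e j → i ≡ j) →
             (d : Fin m → A) → Covers _≈_ d → n ℕ.≤ m
distinct⇒≤ {_≈_ = _≈_} sym trans e distinct d covers =
  Fin.injective⇒≤ {f = proj₁ ∘ covers ∘ e} λ {i} {j} eq → distinct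
    (trans (proj₂ (covers (e i)))
      (sym (≡.subst (λ k → e j ≈ d k) (≡.sym eq) (proj₂ (covers (e j))))))

module _ {A : Set a} {P : Pred A p} (d : Fin m → A) (e : Fin n → A) where

  ++⁺ˡ : ∀ {i} → P (d i) → ∃ λ k → P ((d ++ e) k)
  ++⁺ˡ {i} Pd = i ↑ˡ n , ≡.subst P (≡.sym (Vector.lookup-++ˡ d e i)) Pd

  ++⁺ʳ : ∀ {j} → P (e j) → ∃ λ k → P ((d ++ e) k)
  ++⁺ʳ {j} Pe = m ↑ʳ j , ≡.subst P (≡.sym (Vector.lookup-++ʳ d e j)) Pe

-- Mixed-radix digits of an index, the most significant one at `zero`. With the next two lemmas this
-- is a bijection between `Fin (∏ d)` and the dependent tuples, taken up to pointwise equality.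
choice : (d : Fin n → ℕ) → Fin (∏ d) → ∀ i → Fin (d i)
choice d k zero    = proj₁ (remQuot (∏ (d ∘ suc)) k)
choice d k (suc i) = choice (d ∘ suc) (proj₂ (remQuot {d zero} (∏ (d ∘ suc)) k)) i

choice-injective : (d : Fin n → ℕ) {k l : Fin (∏ d)} →
                   (∀ i → choice d k i ≡ choice d l i) → k ≡ l
choice-injective {zero}  d {zero} {zero} eq = refl
choice-injective {suc n} d {k}    {l}    eq = begin
  k                                     ≡⟨ Fin.combine-remQuot {d zero} r k ⟨
  uncurry combine (remQuot {d zero} r k)
    ≡⟨ cong₂ combine (eq zero) (choice-injective (d ∘ suc) (eq ∘ suc)) ⟩
  uncurry combine (remQuot {d zero} r l) ≡⟨ Fin.combine-remQuot {d zero} r l ⟩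
  l                                     ∎
  where
  open ≡.≡-Reasoning
  r = ∏ (d ∘ suc)

choice-surjective : (d : Fin n → ℕ) (t : ∀ i → Fin (d i)) → ∃ λ k → ∀ i → choice d k i ≡ t i
choice-surjective {zero}  d t = zero , λ ()
choice-surjective {suc n} d t with choice-surjective (d ∘ suc) (t ∘ suc)
... | k , eq = combine (t zero) k , λ
  { zero    → cong proj₁ split
  ; (suc i) → ≡.trans (cong (λ z → choice (d ∘ suc) (proj₂ z) i) split) (eq i)
  }
  where
  split : remQuot (∏ (d ∘ suc)) (combine (t zero) k) ≡ (t zero , k)
  split = Fin.remQuot-combine (t zero) k

tuple : {A : Fin n → Set a} {d : Fin n → ℕ} → (∀ i → Fin (d i) → A i) → Fin (∏ d) → ∀ i → A i
tuple {d = d} e k i = e i (choice d k i)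

-- Covering is asked only of the components of the one tuple `x`, so that it also applies when the
-- families cover just a part of each factor, such as its units.
tuple-covers : {A : Fin n → Set a} {d : Fin n → ℕ}
               (_≈_ : ∀ i → Rel (A i) ℓ) (e : ∀ i → Fin (d i) → A i) (x : ∀ i → A i) →
               (∀ i → ∃ λ j → _≈_ i (x i) (e i j)) →
               ∃ λ k → ∀ i → _≈_ i (x i) (tuple e k i)
tuple-covers {d = d} _≈_ e x covers =
  let k , eq = choice-surjective d (proj₁ ∘ covers)
  in k , λ i → ≡.subst (λ j → _≈_ i (x i) (e i j)) (≡.sym (eq i)) (proj₂ (covers i))

-- Linear algebra

-- The standard basis vector at `p`. In the form of an insertion it splits along `punchIn p`, just
-- as `sum-remove` splits a sum.
indicator : Fin (suc k) → Fin (suc k) → ℚ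
indicator p = insertAt (λ _ → 0ℚ) p 1ℚ

indicator-same : (p : Fin (suc k)) → indicator p p ≡ 1ℚ
indicator-same p = Vector.insertAt-lookup (λ _ → 0ℚ) p 1ℚ

indicator-other : {p q : Fin (suc k)} → p ≢ q → indicator p q ≡ 0ℚ
indicator-other {p = p} p≢q = ≡.trans
  (cong (indicator p) (≡.sym (Fin.punchIn-punchOut p≢q)))
  (Vector.insertAt-punchIn (λ _ → 0ℚ) p 1ℚ (punchOut p≢q))

∑-indicator : (p : Fin (suc k)) (w : Fin (suc k) → ℚ) →
              ∑[ i < suc k ] (indicator p i ℚ.* w i) ≡ w p
∑-indicator {k} p w = begin
  ∑[ i < suc k ] (indicator p i ℚ.* w i)
    ≡⟨ sum-remove {i = p} (λ i → indicator p i ℚ.* w i) ⟩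
  indicator p p ℚ.* w p ℚ.+
    ∑[ i < k ] (indicator p (punchIn p i) ℚ.* w (punchIn p i))
    ≡⟨ cong₂ ℚ._+_
         (≡.trans (cong (ℚ._* w p) (indicator-same p)) (ℚ.*-identityˡ (w p)))
         (≡.trans (sum-cong-≗ λ i → ≡.trans
           (cong (ℚ._* w (punchIn p i)) (Vector.insertAt-punchIn (λ _ → 0ℚ) p 1ℚ i))
           (ℚ.*-zeroˡ (w (punchIn p i))))
           (sum-replicate-zero k)) ⟩
  w p ℚ.+ 0ℚ ≡⟨ ℚ.+-identityʳ (w p) ⟩
  w p ∎
  where open ≡.≡-Reasoning

-- If `p` and `q` differed, the difference of their basis vectors would be the coefficients of a
-- vanishing combination, with coefficient 1 at `p`.
independent⇒distinct : (v : Fin k → Fin m → ℚ) → LinearlyIndependent v →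
                       ∀ {p q} → v p ≗ v q → p ≡ q
independent⇒distinct {suc k} v li {p} {q} vp≗vq with p Fin.≟ q
... | yes p≡q = p≡q
... | no  p≢q = contradiction (≡.trans (≡.sym cp≡1) (li c relation p)) λ ()
  where
  open ≡.≡-Reasoning
  open ℚ-Solver.+-*-Solver

  c : Fin (suc k) → ℚ
  c i = indicator p i ℚ.- indicator q i

  cp≡1 : c p ≡ 1ℚ
  cp≡1 = cong₂ ℚ._-_ (indicator-same p) (indicator-other (p≢q ∘ ≡.sym))

  relation : ∀ j → ∑[ i < suc k ] (c i ℚ.* v i j) ≡ 0ℚ
  relation j = begin
    ∑[ i < suc k ] (c i ℚ.* v i j)
      -- The sign moves from the coefficient to the vector, so that `∑-indicator` evaluates both
      -- sums.
      ≡⟨ sum-cong-≗ (λ i → solve 3 (λ x y z → (x :- y) :* z := x :* z :+ y :* (:- z)) refl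
           (indicator p i) (indicator q i) (v i j)) ⟩
    ∑[ i < suc k ] (indicator p i ℚ.* v i j ℚ.+ indicator q i ℚ.* (ℚ.- v i j))
      ≡⟨ ∑-distrib-+ (λ i → indicator p i ℚ.* v i j) (λ i → indicator q i ℚ.* (ℚ.- v i j)) ⟩
    _ ≡⟨ cong₂ ℚ._+_ (∑-indicator p (λ i → v i j)) (∑-indicator q (λ i → ℚ.- v i j)) ⟩
    v p j ℚ.- v q j ≡⟨ cong (ℚ._- v q j) (vp≗vq j) ⟩
    v q j ℚ.- v q j ≡⟨ ℚ.+-inverseʳ (v q j) ⟩
    0ℚ ∎

-- Finite commutative rings

module FiniteRing {c ℓ} (R : FiniteCommutativeRing c ℓ) where
  open FiniteCommutativeRing R hiding (commutativeRing; card; units; Γ; ΓE; refl; zero)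
  open Inverse enumeration using ()
    renaming (from to element; to-cong to index-cong;
              strictlyInverseʳ to element-index; strictlyInverseˡ to index-element)
  open GroupProperties +-group using (x∙y⁻¹≈ε⇒x≈y)
  open RingProperties ring using (x[y-z]≈xy-xz)
  open SetoidMembership setoid using (_∈_)

  ∼-setoid : Setoid c (c ⊔ ℓ)
  ∼-setoid = record
    { Carrier = Carrier
    ; _≈_ = _∼_
    ; isEquivalence = record
      { refl  = (λ p → p) , (λ p → p)
      ; sym   = swap
      ; trans = λ (f , g) (f′ , g′) → f′ ∘ f , g ∘ g′
      }
    }

  open Setoid ∼-setoid using () renaming (sym to ∼-sym; trans to ∼-trans)

  ≈⇒∼ : ∀ {x y} → x ≈ y → x ∼ y
  ≈⇒∼ x≈y = trans (*-congʳ (sym x≈y)) , trans (*-congʳ x≈y)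

  elements-cover : Covers _≈_ element
  elements-cover x = _ , sym (element-index x)

  elements-distinct : ∀ {i j} → element i ≈ element j → i ≡ j
  elements-distinct {i} {j} eq =
    ≡.trans (≡.sym (index-element i)) (≡.trans (index-cong eq) (index-element j))

  ∈-elements : ∀ x → x ∈ elements
  ∈-elements x = Any.map (trans (sym (element-index x)))
    (Membership.∈-tabulate⁺ setoid _)

  IsUnit-resp : ∀ {x y} → x ≈ y → IsUnit x → IsUnit y
  IsUnit-resp x≈y (z , zx≈1 , xz≈1) =
    z , trans (*-congˡ (sym x≈y)) zx≈1 , trans (*-congʳ (sym x≈y)) xz≈1

  ∃-unit : ∀ {x} → IsUnit x → ∃ λ k → x ≈ lookup (units R) k
  ∃-unit {x} x-unit = _ ,
    lookup-index (Membership.∈-filter⁺ setoid isUnit? IsUnit-resp (∈-elements x) x-unit)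

  IsVertex : Pred Carrier _
  IsVertex x = ¬ x ≈ 0# × IsZeroDivisor x

  IsVertex-resp : ∀ {x y} → x ≈ y → IsVertex x → IsVertex y
  IsVertex-resp x≈y (x≉0 , z , z≉0 , xz≈0) =
    x≉0 ∘ trans x≈y , z , z≉0 , trans (*-congʳ (sym x≈y)) xz≈0

  ∃-vertex : ∀ {x} → IsVertex x → ∃ λ k → x ≈ lookup Z* k
  ∃-vertex {x} x-vertex = _ , lookup-index
    (Membership.∈-filter⁺ setoid _ IsVertex-resp (∈-elements x) x-vertex)

  lookup-Z* : ∀ k → IsVertex (lookup Z* k)
  lookup-Z* k = All.lookup (all-filter _ elements) (∈-lookup k)

  -- `Ann 0#` contains `1#`, while `Ann 1#` contains only zero. The annihilator of a vertex lies
  -- strictly between them, which separates it from both in the next two lemmas.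
  0≁1 : ¬ 0# ∼ 1#
  0≁1 (f , _) = 1≉0 (trans (sym (*-identityˡ 1#)) (f (zeroˡ 1#)))

  vertex≁0 : ∀ {x} → IsVertex x → ¬ x ∼ 0#
  vertex≁0 {x} (x≉0 , _) (_ , f) = x≉0 (trans (sym (*-identityʳ x)) (f (zeroˡ 1#)))

  vertex≁1 : ∀ {x} → IsVertex x → ¬ x ∼ 1#
  vertex≁1 (_ , z , z≉0 , xz≈0) (f , _) = z≉0 (trans (sym (*-identityˡ z)) (f xz≈0))

  -- Multiplication by a non-zero-divisor is injective. If `x` were not a unit, `1#` would lie
  -- outside its image, and together with the image it would give one element more than the ring
  -- has.
  ¬zeroDivisor⇒unit : ∀ {x} → ¬ IsZeroDivisor x → IsUnit x
  ¬zeroDivisor⇒unit {x} ¬zd with isUnit? x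
  ... | yes x-unit = x-unit
  ... | no ¬unit   = contradiction
    (distinct⇒≤ sym trans e distinct element elements-cover) ℕ.1+n≰n
    where
    e : Fin (suc (card R)) → Carrier
    e = 1# ◂ (λ i → x *ᴿ element i)

    1≉xy : ∀ y → ¬ 1# ≈ x *ᴿ y
    1≉xy y 1≈xy = ¬unit (y , trans (*-comm y x) (sym 1≈xy) , sym 1≈xy)

    cancel : ∀ y z → x *ᴿ y ≈ x *ᴿ z → y ≈ z
    -- A nonzero difference `y -ᴿ z` would be annihilated by `x` and make it a zero-divisor.
    cancel y z xy≈xz with (y -ᴿ z) ≈? 0#
    ... | yes eq = x∙y⁻¹≈ε⇒x≈y y z eq
    ... | no neq = contradiction
      (y -ᴿ z , neq , trans (x[y-z]≈xy-xz x y z) (trans (+-congʳ xy≈xz) (-‿inverseʳ _))) ¬zd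

    distinct : ∀ {i j} → e i ≈ e j → i ≡ j
    distinct {zero}  {zero}  _  = refl
    distinct {zero}  {suc j} eq = contradiction eq (1≉xy _)
    distinct {suc i} {zero}  eq = contradiction (sym eq) (1≉xy _)
    distinct {suc i} {suc j} eq = cong suc (elements-distinct (cancel _ _ eq))

  trichotomy : ∀ x → IsVertex x ⊎ IsUnit x ⊎ x ≈ 0#
  trichotomy x with x ≈? 0# | isZeroDivisor? x
  ... | yes x≈0 | _       = inj₂ (inj₂ x≈0)
  ... | no  x≉0 | yes zd  = inj₁ (x≉0 , zd)
  ... | no  _   | no  ¬zd = inj₂ (inj₁ (¬zeroDivisor⇒unit ¬zd))

  -- Repeats the vertex list inside `ΓE`, so that its length is `order (ΓE R)` by computation.
  ΓE-vertices : List Carrier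
  ΓE-vertices = filter (λ x → ¬? (x ∼? 0#) ×-dec ¬? (x ∼? 1#)) classes

  -- Puts back the two classes that `ΓE` leaves out; this is where the 2 in each factor of the bound
  -- comes from.
  representative : Fin (order (ΓE R) ℕ.+ 2) → Carrier
  representative = lookup ΓE-vertices ++ (0# ◂ 1# ◂ [])

  representatives-cover : Covers _∼_ representative
  representatives-cover x with x ∼? 0# | x ∼? 1#
  ... | yes x∼0 | _       = ++⁺ʳ {P = x ∼_} (lookup ΓE-vertices) _ {zero} x∼0
  ... | no _    | yes x∼1 = ++⁺ʳ {P = x ∼_} (lookup ΓE-vertices) _ {suc zero} x∼1
  ... | no x≁0  | no x≁1  = ++⁺ˡ {P = x ∼_} (lookup ΓE-vertices) _ (lookup-index
    (Membership.∈-filter⁺ ∼-setoid _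
      (λ x∼y (x≁0 , x≁1) → x≁0 ∘ ∼-trans x∼y , x≁1 ∘ ∼-trans x∼y)
      -- `deduplicate` may drop `x` itself but keeps a member of its class, so membership is taken
      -- in `∼-setoid`.
      (Membership.∈-deduplicate⁺ ∼-setoid _∼?_ (λ z∼y x∼y → ∼-trans x∼y (∼-sym z∼y))
        (Any.map ≈⇒∼ (∈-elements x)))
      (x≁0 , x≁1)))

  -- Up to commutativity, entry `l` of column `i` records whether vertex `l` annihilates vertex `i`.
  -- Since loops are kept, the diagonal entries follow the same rule.
  ∼⇒column≗ : ∀ {i j} → lookup Z* i ∼ lookup Z* j →
              column (Graph.adjacencyMatrix (Γ R)) i ≗ column (Graph.adjacencyMatrix (Γ R)) j
  ∼⇒column≗ (f , g) l = cong (λ b → if b then 1ℚ else 0ℚ) (does-⇔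
    (mk⇔ (trans (*-comm _ _) ∘ f ∘ trans (*-comm _ _))
         (trans (*-comm _ _) ∘ g ∘ trans (*-comm _ _)))
    (_ ≈? _) (_ ≈? _))

  rank-bound : (d : Fin m → Carrier) → Covers _∼_ d →
               2 ℕ.+ rank (Graph.adjacencyMatrix (Γ R)) ℕ.≤ m
  rank-bound d covers = distinct⇒≤ ∼-sym ∼-trans e distinct d covers
    where
    M = Graph.adjacencyMatrix (Γ R)
    f = proj₁ (proj₁ (rank-isRank M))
    independent = proj₂ (proj₁ (rank-isRank M))

    -- `f` selects a largest independent family of columns. In front of it stand the two classes
    -- that no vertex represents.
    e : Fin (2 ℕ.+ rank M) → Carrier
    e = 0# ◂ 1# ◂ (lookup Z* ∘ f)

    distinct : ∀ {i j} → e i ∼ e j → i ≡ j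
    distinct {zero}        {zero}        _  = refl
    distinct {zero}        {suc zero}    eq = contradiction eq 0≁1
    distinct {zero}        {suc (suc j)} eq = contradiction (∼-sym eq) (vertex≁0 (lookup-Z* (f j)))
    distinct {suc zero}    {zero}        eq = contradiction (∼-sym eq) 0≁1
    distinct {suc zero}    {suc zero}    _  = refl
    distinct {suc zero}    {suc (suc j)} eq = contradiction (∼-sym eq) (vertex≁1 (lookup-Z* (f j)))
    distinct {suc (suc i)} {zero}        eq = contradiction eq (vertex≁0 (lookup-Z* (f i)))
    distinct {suc (suc i)} {suc zero}    eq = contradiction eq (vertex≁1 (lookup-Z* (f i)))
    distinct {suc (suc i)} {suc (suc j)} eq =
      cong (λ k → suc (suc k)) (independent⇒distinct (column M ∘ f) independent (∼⇒column≗ eq))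

-- Rings isomorphic to a product

module _ {n} (R : FiniteCommutativeRing c₁ ℓ₁) (Rᵢ : Fin n → FiniteCommutativeRing c₂ ℓ₂)
         (R≅∏ : commutativeRing R ≅ Product (λ i → commutativeRing (Rᵢ i))) where
  private
    module R = FiniteCommutativeRing R
    module Rᵢ (i : Fin n) = FiniteCommutativeRing (Rᵢ i)
    module P = CommutativeRing (Product (λ i → commutativeRing (Rᵢ i)))
    open FiniteRing

  φ : R.Carrier → P.Carrier
  φ = proj₁ R≅∏

  open RingMorphisms.IsRingIsomorphism (proj₂ R≅∏)
    using (*-homo; 0#-homo; 1#-homo; ⟦⟧-cong; injective; surjective)

  φ-unit : ∀ {x} → R.IsUnit x → ∀ i → Rᵢ.IsUnit i (φ x i)
  φ-unit {x} (y , yx≈1 , xy≈1) i = φ y i ,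
    P.trans (P.sym (*-homo y x)) (P.trans (⟦⟧-cong yx≈1) 1#-homo) i ,
    P.trans (P.sym (*-homo x y)) (P.trans (⟦⟧-cong xy≈1) 1#-homo) i

  φ-zeroProduct : ∀ {x z} → x R.*ᴿ z R.≈ R.0# → φ x P.* φ z P.≈ P.0#
  φ-zeroProduct {x} {z} xz≈0 =
    P.trans (P.sym (*-homo x z)) (P.trans (⟦⟧-cong xz≈0) 0#-homo)

  φ-zeroProduct⁻ : ∀ {x z} → φ x P.* φ z P.≈ P.0# → x R.*ᴿ z R.≈ R.0#
  φ-zeroProduct⁻ {x} {z} φxφz≈0 =
    injective (P.trans (*-homo x z) (P.trans φxφz≈0 (P.sym 0#-homo)))

  -- A product in the image of `φ` vanishes exactly when each component does, and injectivity
  -- carries this back to the ring `R`.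
  φ-∼ : ∀ {x y} → (∀ i → Rᵢ._∼_ i (φ x i) (φ y i)) → x R.∼ y
  φ-∼ φx∼φy =
    (λ xz≈0 → φ-zeroProduct⁻ λ i → proj₁ (φx∼φy i) (φ-zeroProduct xz≈0 i)) ,
    (λ yz≈0 → φ-zeroProduct⁻ λ i → proj₂ (φx∼φy i) (φ-zeroProduct yz≈0 i))

  φ⁻¹ : P.Carrier → R.Carrier
  φ⁻¹ t = proj₁ (surjective t)

  φ-φ⁻¹ : ∀ t → φ (φ⁻¹ t) P.≈ t
  -- `surjective` speaks of every element equal to the chosen preimage; reflexivity picks the
  -- preimage itself.
  φ-φ⁻¹ t = proj₂ (surjective t) R.refl

  -- The count takes place in the product: all tuples are pairwise distinct there, and each is
  -- covered by the image of a vertex, a tuple of units or zero. `trichotomy` is applied in `R` to a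
  -- preimage of the tuple.
  card-bound : ∏ (card ∘ Rᵢ) ℕ.≤
               length R.Z* ℕ.+ ∏ (λ i → length (units (Rᵢ i))) ℕ.+ 1
  card-bound = distinct⇒≤ {_≈_ = P._≈_}
    (λ {x} {y} → P.sym {x} {y}) (λ {x} {y} {z} → P.trans {x} {y} {z})
    (tuple element) distinct cover covers
    where
    element : ∀ i → Fin (card (Rᵢ i)) → Rᵢ.Carrier i
    element i = Inverse.from (Rᵢ.enumeration i)

    distinct : ∀ {k l} → tuple element k P.≈ tuple element l → k ≡ l
    distinct eq = choice-injective (card ∘ Rᵢ) λ i → elements-distinct (Rᵢ i) (eq i)

    unitTuple : Fin (∏ (λ i → length (units (Rᵢ i)))) → P.Carrier
    unitTuple = tuple (λ i → lookup (units (Rᵢ i)))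

    nonzero : Fin (length R.Z* ℕ.+ ∏ (λ i → length (units (Rᵢ i)))) → P.Carrier
    nonzero = (φ ∘ lookup R.Z*) ++ unitTuple

    cover : Fin (length R.Z* ℕ.+ ∏ (λ i → length (units (Rᵢ i))) ℕ.+ 1) → P.Carrier
    cover = nonzero ++ (P.0# ◂ [])

    covers-image : ∀ x → ∃ λ k → φ x P.≈ cover k
    covers-image x with trichotomy R x
    ... | inj₁ x-vertex =
      let k , x≈ = ∃-vertex R x-vertex
          l , φx≈ = ++⁺ˡ {P = φ x P.≈_} (φ ∘ lookup R.Z*) unitTuple {k} (⟦⟧-cong x≈)
      in ++⁺ˡ {P = φ x P.≈_} nonzero _ {l} φx≈
    ... | inj₂ (inj₁ x-unit) =
      let k , φx≈ = tuple-covers Rᵢ._≈_ (λ i → lookup (units (Rᵢ i))) (φ x) λ i →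
                      ∃-unit (Rᵢ i) (φ-unit x-unit i)
          l , φx≈ = ++⁺ʳ {P = φ x P.≈_} (φ ∘ lookup R.Z*) unitTuple {k} φx≈
      in ++⁺ˡ {P = φ x P.≈_} nonzero _ {l} φx≈
    ... | inj₂ (inj₂ x≈0) =
      ++⁺ʳ {P = φ x P.≈_} nonzero _ {zero} (P.trans (⟦⟧-cong x≈0) 0#-homo)

    covers : Covers P._≈_ cover
    covers t =
      let k , φx≈ = covers-image (φ⁻¹ t)
      in k , P.trans (P.sym (φ-φ⁻¹ t)) φx≈

  -- Preimages of the tuples of class representatives meet every class of `R`, because `φ-∼`
  -- compares annihilators component by component.
  classes-bound : 2 ℕ.+ rank (Graph.adjacencyMatrix (Γ R)) ℕ.≤
                  ∏ (λ i → order (ΓE (Rᵢ i)) ℕ.+ 2)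
  classes-bound = rank-bound R (φ⁻¹ ∘ tuple (representative ∘ Rᵢ)) λ x →
    let k , φx∼ = tuple-covers Rᵢ._∼_ (representative ∘ Rᵢ) (φ x) λ i →
                    representatives-cover (Rᵢ i) (φ x i)
    -- `φ` returns the tuple of representatives only up to equality in the product, which `≈⇒∼`
    -- turns into equality of classes.
    in k , φ-∼ λ i → Setoid.trans (∼-setoid (Rᵢ i)) (φx∼ i)
             (≈⇒∼ (Rᵢ i) (Rᵢ.sym i (φ-φ⁻¹ (tuple (representative ∘ Rᵢ) k) i)))

  nullity-bound : ∏ (card ∘ Rᵢ) ℕ.+ 1 ℕ.≤
    nullity (Γ R) ℕ.+ (∏ (λ i → length (units (Rᵢ i))) ℕ.+ ∏ (λ i → order (ΓE (Rᵢ i)) ℕ.+ 2))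
  nullity-bound = begin
    ∏ (card ∘ Rᵢ) ℕ.+ 1
      ≤⟨ ℕ.+-monoˡ-≤ 1 card-bound ⟩
    length R.Z* ℕ.+ u ℕ.+ 1 ℕ.+ 1
      -- `nullity` is a truncated difference; this is the inequality that truncation preserves.
      ≤⟨ ℕ.+-monoˡ-≤ 1 (ℕ.+-monoˡ-≤ 1 (ℕ.+-monoˡ-≤ u (ℕ.m≤n+m∸n (length R.Z*) ρ))) ⟩
    ρ ℕ.+ nullity (Γ R) ℕ.+ u ℕ.+ 1 ℕ.+ 1
      -- One of the two ones counts the zero element, the other is the summand 1 of the claim.
      -- Together they supply the 2 that `classes-bound` requires next to the rank.
      ≡⟨ solve 3 (λ r z u → r :+ z :+ u :+ con 1 :+ con 1 := z :+ (u :+ (con 2 :+ r))) refl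
           ρ (nullity (Γ R)) u ⟩
    nullity (Γ R) ℕ.+ (u ℕ.+ (2 ℕ.+ ρ))
      ≤⟨ ℕ.+-monoʳ-≤ (nullity (Γ R)) (ℕ.+-monoʳ-≤ u classes-bound) ⟩
    nullity (Γ R) ℕ.+ (u ℕ.+ ∏ (λ i → order (ΓE (Rᵢ i)) ℕ.+ 2)) ∎
    where
    open ℕ.≤-Reasoning
    open ℕ-Solver.+-*-Solver
    u = ∏ (λ i → length (units (Rᵢ i)))
    ρ = rank (Graph.adjacencyMatrix (Γ R))

-- Passage from natural numbers to integers

m+1≤n+[k+l]⇒m-k-l+1≤n : ∀ m n k l → m ℕ.+ 1 ℕ.≤ n ℕ.+ (k ℕ.+ l) → + n ≥ + m - + k - + l + + 1
m+1≤n+[k+l]⇒m-k-l+1≤n m n k l le = begin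
  + m - + k - + l + + 1
    ≡⟨ solve 3 (λ m k l → m :- k :- l :+ con (+ 1) := (m :+ con (+ 1)) :- (k :+ l)) refl
         (+ m) (+ k) (+ l) ⟩
  -- Integer sums of embedded naturals compute to embedded sums, so the solver's result already has
  -- this form.
  + (m ℕ.+ 1) - + (k ℕ.+ l)
    ≤⟨ ℤ.+-monoˡ-≤ (ℤ.- + (k ℕ.+ l)) (ℤ.+≤+ le) ⟩
  + (n ℕ.+ (k ℕ.+ l)) - + (k ℕ.+ l)
    ≡⟨ solve 2 (λ n s → (n :+ s) :- s := n) refl (+ n) (+ (k ℕ.+ l)) ⟩
  + n ∎
  where
  open ℤ.≤-Reasoning
  open ℤ-Solver.+-*-Solver

theorem3p5 : ∀ {c₁ ℓ₁ c₂ ℓ₂ : Level} (r : ℕ) → r ℕ.≥ 1 →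
    (R : FiniteCommutativeRing c₁ ℓ₁) (Rᵢ : Fin r → FiniteCommutativeRing c₂ ℓ₂) →
    (∀ i → IsLocal (commutativeRing (Rᵢ i))) →
    commutativeRing R ≅ Product (λ i → commutativeRing (Rᵢ i)) →
    + nullity (Γ R) ≥
    + ∏ (λ i → card (Rᵢ i)) - + ∏ (λ i → length (units (Rᵢ i)))
    - + ∏ (λ i → order (ΓE (Rᵢ i)) ℕ.+ 2) + + 1
theorem3p5 r _ R Rᵢ _ R≅∏ = m+1≤n+[k+l]⇒m-k-l+1≤n _ _
  (∏ (λ i → length (units (Rᵢ i)))) (∏ (λ i → order (ΓE (Rᵢ i)) ℕ.+ 2))
  (nullity-bound R Rᵢ R≅∏)
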